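{- Let $(S,+)$ be an uncountable semigroup with no idempotent element. Then the following are equivalent: (a) every uncountable IP set $A\subseteq S$ can be partitioned into uncountably many pairwise disjoint sets each of which is an IP set; (b) every uncountable subset of $S$ is an IP set.
   Context: $e$ is idempotent if $e+e=e$. For a sequence $\langle x_n\rangle_{n=1}^\infty$ in $S$, $\mathrm{FS}(\langle x_n\rangle_{n=1}^\infty)$ is the set of all sums $\sum_{n\in H}x_n$ (in increasing order of indices) with $H$ a nonempty finite subset of $\mathbb{N}$. $A\subseteq S$ is an IP set if $\mathrm{FS}(\langle x_n\rangle_{n=1}^\infty)\subseteq A$ for some sequence $\langle x_n\rangle_{n=1}^\infty$ in $S$. -}

module Defs where

open import Level using (Level; _⊔_; suc)
open import Algebra.Bundles using (Semigroup)
open import Data.List.NonEmpty using (List⁺; toList; foldr₁; map)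
open import Data.List.Relation.Unary.Linked using (Linked)
open import Data.Nat using (ℕ; _<_)
open import Data.Product using (Σ; ∃; _×_; proj₁)
open import Function.Bundles using (Func; Injection)
open import Relation.Binary.Bundles using (Setoid)
open import Relation.Binary.Definitions using (_Respects_)
import Relation.Binary.Construct.On as On
open import Relation.Binary.PropositionalEquality using (_≢_; setoid)
open import Relation.Nullary using (¬_)
open import Relation.Unary using (Pred; _⊆_; _⊥_; _≐_; ⋃)

-- The choice function must respect the equality of X.  Without that demand
-- the principle would be a mere projection; with it (and excluded middle) it
-- has the strength of the set-theoretic axiom, X playing the role of a
-- quotient set.
AxiomOfChoice : (a ℓ b r : Level) → Set (suc (a ⊔ ℓ ⊔ b ⊔ r))
AxiomOfChoice a ℓ b r =
  (X : Setoid a ℓ) (Y : Set b) (R : Setoid.Carrier X → Y → Set r) →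
  (∀ {y} → (λ x → R x y) Respects Setoid._≈_ X) →
  (∀ x → ∃ λ y → R x y) →
  Σ (Func X (setoid Y)) λ f → ∀ x → R x (Func.to f x)

Uncountable : {a ℓ : Level} → Setoid a ℓ → Set (a ⊔ ℓ)
Uncountable X = ¬ Injection X (setoid ℕ)

module _ {c ℓ : Level} (S : Semigroup c ℓ) where
  open Semigroup S using (Carrier; _≈_; _∙_) renaming (setoid to S-setoid)

  record Subset : Set (suc (c ⊔ ℓ)) where
    field
      member : Pred Carrier (c ⊔ ℓ)
      resp   : member Respects _≈_

  open Subset

  subsetSetoid : Subset → Setoid (c ⊔ ℓ) ℓ
  subsetSetoid A = On.setoid {B = Σ Carrier (member A)} S-setoid proj₁

  -- A nonempty finite subset H of ℕ is given by its strictly increasing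
  -- enumeration, so that the sum is taken in increasing order of indices.
  FS : (ℕ → Carrier) → Pred Carrier ℓ
  FS x s = ∃ λ (H : List⁺ ℕ) →
    Linked _<_ (toList H) × s ≈ foldr₁ _∙_ (map x H)

  IsIP : Subset → Set (c ⊔ ℓ)
  IsIP A = ∃ λ (x : ℕ → Carrier) → FS x ⊆ member A

  -- IP sets are nonempty, so disjointness of the parts at distinct indices
  -- makes the indexing injective: "uncountably many parts" is
  -- uncountability of the index set.
  record UncountableIPPartition (A : Subset) : Set (suc (c ⊔ ℓ)) where
    field
      Index       : Set (c ⊔ ℓ)
      part        : Index → Subset
      uncountable : Uncountable (setoid Index)
      disjoint    : ∀ {i j} → i ≢ j → member (part i) ⊥ member (part j)
      covers      : ⋃ Index (λ i → member (part i)) ≐ member A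
      part-IP     : ∀ i → IsIP (part i)

{-# OPTIONS --safe #-}
module Submission where

-- (a) ⇒ (b): adjoin to an uncountable set A the multiples of one of its
-- elements.  The result is an uncountable IP set, and only countably many parts
-- of a partition of it can meet the countable set of multiples; any other part
-- is an IP set contained in A.
--
-- (b) ⇒ (a): it suffices to split an uncountable set into uncountably many
-- uncountable sets.  Brouwer ordinals, taken up to mutual inequality, play the
-- role of ω₁: "uncountable" becomes "unbounded", and every ordinal enumerates
-- its predecessors.  Let A(n, α) be the set of β > α whose n-th predecessor is
-- α (an Ulam matrix).  For fixed n these sets are disjoint, for fixed α their
-- union over n is unbounded; hence one n has unboundedly many α with A(n, α)
-- unbounded.  An injection of ω₁ into the given set carries this row over.

open import Defs
open import Level using (Level; Lift; lift; lower; _⊔_)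
open import Algebra.Bundles using (Semigroup)
open import Algebra.Definitions using (_IdempotentOn_)
open import Axiom.ExcludedMiddle using (ExcludedMiddle)
open import Data.Empty using (⊥-elim)
open import Data.Irrelevant using ([_])
open import Data.List.Base using ([]; _∷_; length)
open import Data.List.NonEmpty as List⁺ using (foldr₁)
open import Data.Nat.Base using (ℕ; zero; suc; _+_)
open import Data.Nat.Properties using (+-identityʳ; +-suc)
open import Data.Product using (Σ; ∃; ∃₂; _×_; _,_; proj₁; proj₂)
open import Data.Refinement.Base using (Refinement; _,_; value)
open import Data.Sum.Base using (_⊎_; inj₁; inj₂; [_,_]′)
open import Function.Base using (_∘_; const)
open import Function.Bundles using (_⇔_; mk⇔; Func; Injection)
open import Function.Relation.Binary.Setoid.Equality using (_⇨_)
open import Induction.WellFounded using (Acc; acc; WellFounded)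
open import Relation.Binary.Bundles using (Setoid)
import Relation.Binary.Construct.On as On
open import Relation.Binary.PropositionalEquality
  using (_≡_; refl; sym; trans; cong; subst; setoid)
open import Relation.Nullary using (¬_; Dec; yes; no; contradiction)
open import Relation.Nullary.Decidable using (recompute)
open import Relation.Unary using (Pred; ⋃)

private
  variable
    a b p : Level

-- Enumeration of pairs of naturals

unpair : ℕ → ℕ × ℕ
unpair zero    = 0 , 0
unpair (suc n) = next (unpair n)
  where
  next : ℕ × ℕ → ℕ × ℕ
  next (x , suc y) = suc x , y
  next (x , zero)  = 0 , suc x

-- The walk runs along each antidiagonal from `(0 , s)` to `(s , 0)`, then on to `(0 , suc s)`; the
-- recursion retraces it.
unpair-surjective : ∀ x y → ∃ λ n → unpair n ≡ (x , y)
unpair-surjective x y = onDiagonal (x + y) x y refl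
  where
  step : ∀ {x y} → (∃ λ n → unpair n ≡ (x , suc y)) → ∃ λ n → unpair n ≡ (suc x , y)
  step (n , eq) = suc n , lemma eq
    where
    lemma : ∀ {x y} → unpair n ≡ (x , suc y) → unpair (suc n) ≡ (suc x , y)
    lemma eq rewrite eq = refl

  wrap : ∀ {x} → (∃ λ n → unpair n ≡ (x , zero)) → ∃ λ n → unpair n ≡ (0 , suc x)
  wrap (n , eq) = suc n , lemma eq
    where
    lemma : ∀ {x} → unpair n ≡ (x , zero) → unpair (suc n) ≡ (0 , suc x)
    lemma eq rewrite eq = refl

  onDiagonal : ∀ s x y → x + y ≡ s → ∃ λ n → unpair n ≡ (x , y)
  onDiagonal s       (suc x) y       eq   = step (onDiagonal s x (suc y) (trans (+-suc x y) eq))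
  onDiagonal zero    zero    zero    eq   = 0 , refl
  onDiagonal (suc s) zero    (suc y) refl = wrap (onDiagonal y y 0 (+-identityʳ y))

-- Brouwer ordinals

-- node f is the least ordinal above all f n.
data Ord : Set where
  zero : Ord
  node : (ℕ → Ord) → Ord

infix 4 _≤_ _<_ _~_

data _≤_ : Ord → Ord → Set
data _<_ : Ord → Ord → Set

data _≤_ where
  zero≤ : ∀ {β} → zero ≤ β
  node≤ : ∀ {f β} → (∀ n → f n < β) → node f ≤ β

data _<_ where
  <node : ∀ {α g} n → α ≤ g n → α < node g

_~_ : Ord → Ord → Set
α ~ β = α ≤ β × β ≤ α

≤-refl : ∀ {α} → α ≤ α
≤-refl {zero}   = zero≤
≤-refl {node f} = node≤ λ n → <node n ≤-refl

≤-trans   : ∀ {α β γ} → α ≤ β → β ≤ γ → α ≤ γ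
<-≤-trans : ∀ {α β γ} → α < β → β ≤ γ → α < γ
≤-<-trans : ∀ {α β γ} → α ≤ β → β < γ → α < γ

≤-trans zero≤      _ = zero≤
≤-trans (node≤ lt) q = node≤ λ n → <-≤-trans (lt n) q

<-≤-trans (<node n p) (node≤ lt) = ≤-<-trans p (lt n)

≤-<-trans p (<node n q) = <node n (≤-trans p q)

<⇒≤ : ∀ {α β} → α < β → α ≤ β
<⇒≤ (<node n zero≤)      = zero≤
<⇒≤ (<node n (node≤ lt)) = node≤ λ m → <node n (<⇒≤ (lt m))

~-refl : ∀ {α} → α ~ α
~-refl = ≤-refl , ≤-refl

~-sym : ∀ {α β} → α ~ β → β ~ α
~-sym (p , q) = q , p

~-trans : ∀ {α β γ} → α ~ β → β ~ γ → α ~ γ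
~-trans (p , q) (p′ , q′) = ≤-trans p p′ , ≤-trans q′ q

~-setoid : Setoid _ _
~-setoid = record
  { _≈_           = _~_
  ; isEquivalence = record { refl = ~-refl ; sym = ~-sym ; trans = ~-trans }
  }

<-wellFounded : WellFounded _<_
<-wellFounded α = acc (below α)
  where
  below : ∀ α {β} → β < α → Acc _<_ β
  below (node g) (<node n p) = acc λ q → below (g n) (<-≤-trans q p)

<-irrefl : ∀ {α} → ¬ α < α
<-irrefl {α} = go (<-wellFounded α)
  where
  go : ∀ {α} → Acc _<_ α → ¬ α < α
  go (acc rs) p = go (rs p) p

-- On zero, which has no predecessor, the value is junk.
predecessor : Ord → ℕ → Ord
predecessor zero     _ = zero
predecessor (node f) n = at (unpair n)
  where
  at : ℕ × ℕ → Ord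
  at (i , zero)  = f i
  at (i , suc j) = predecessor (f i) j

-- Classical order theory of Brouwer ordinals

module Classical
  (em : ∀ (a : Level) → ExcludedMiddle a)
  (ac : ∀ (a b d e : Level) → AxiomOfChoice a b d e)
  where

  decide : (P : Set p) → Dec P
  decide {p} P = em p {P}

  all⊎counterexample : {A : Set a} (P : A → Set p) → (∀ x → P x) ⊎ (∃ λ x → ¬ P x)
  all⊎counterexample P with decide (∃ λ x → ¬ P x)
  ... | yes c = inj₂ c
  ... | no ¬c = inj₁ λ x → holds x (decide (P x))
    where
    holds : ∀ x → Dec (P x) → P x
    holds x (yes p) = p
    holds x (no ¬p) = ⊥-elim (¬c (x , ¬p))

  ≤-<-total : ∀ α β → α ≤ β ⊎ β < α
  ≤-<-total zero     β = inj₁ zero≤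
  ≤-<-total (node f) β with all⊎counterexample (λ n → f n < β)
  ... | inj₁ lt       = inj₁ (node≤ lt)
  ... | inj₂ (n , ≮β) = inj₂ (<node n (≮⇒≥ β ≮β))
    where
    ≮⇒≥ : ∀ β → ¬ f n < β → β ≤ f n
    ≮⇒≥ zero     _ = zero≤
    ≮⇒≥ (node g) ≮ = node≤ λ m →
      [ (λ p → contradiction (<node m p) ≮) , (λ q → q) ]′ (≤-<-total (f n) (g m))

  connex : ∀ {α β} → ¬ α < β → ¬ β < α → α ~ β
  connex {α} {β} α≮β β≮α = below β≮α , below α≮β
    where
    below : ∀ {α β} → ¬ β < α → α ≤ β
    below {α} {β} ≮ = [ (λ p → p) , (λ q → contradiction q ≮) ]′ (≤-<-total α β)

  -- An ordinal below `node g` is at most some `g i`: it is equivalent to `g i`, with code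
  -- `(i , 0)`, or lies below it and is its `j`-th predecessor by recursion, with code
  -- `(i , suc j)`.
  predecessor-surjective : ∀ {α β} → α < β → ∃ λ n → predecessor β n ~ α
  predecessor-surjective {α} {node g} (<node i p) with ≤-<-total (g i) α
  ... | inj₁ q with unpair-surjective i 0
  ...   | n , eq = n , lemma eq
    where
    lemma : unpair n ≡ (i , 0) → predecessor (node g) n ~ α
    lemma eq rewrite eq = q , p
  predecessor-surjective {α} {node g} (<node i p) | inj₂ q
    with predecessor-surjective {α} {g i} q
  ... | j , r with unpair-surjective i (suc j)
  ...   | n , eq = n , lemma eq
    where
    lemma : unpair n ≡ (i , suc j) → predecessor (node g) n ~ α
    lemma eq rewrite eq = r

  -- Unbounded sets of ordinals

  Unbounded : Pred Ord p → Set p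
  Unbounded P = ∀ γ → ∃ λ β → γ ≤ β × P β

  -- Regularity of ω₁: if every `P n` had a bound, the node over these bounds would bound the union.
  unbounded-⋃ : (P : ℕ → Pred Ord p) → Unbounded (⋃ ℕ P) → ∃ λ n → Unbounded (P n)
  unbounded-⋃ P unb with decide (∃ λ n → Unbounded (P n))
  ... | yes q = q
  ... | no ¬q = ⊥-elim (beyond (unb (node (proj₁ ∘ bound))))
    where
    bound : ∀ n → ∃ λ γ → ¬ (∃ λ β → γ ≤ β × P n β)
    bound n with all⊎counterexample (λ γ → ∃ λ β → γ ≤ β × P n β)
    ... | inj₁ u = ⊥-elim (¬q (n , u))
    ... | inj₂ c = c

    beyond : ¬ (∃ λ β → node (proj₁ ∘ bound) ≤ β × ⋃ ℕ P β)
    beyond (β , le , n , Pβ) = proj₂ (bound n) (β , <⇒≤ (<-≤-trans (<node n ≤-refl) le) , Pβ)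

  -- An injection of `Y` into ℕ would cut `P` into countably many classes. One would be unbounded,
  -- although all its members are equivalent.
  unbounded⇒uncountable :
    {P : Pred Ord p} → Unbounded P → (Y : Setoid a b) (g : ∀ β → P β → Setoid.Carrier Y) →
    (∀ {β β′} (q : P β) (q′ : P β′) → Setoid._≈_ Y (g β q) (g β′ q′) → β ~ β′) →
    Uncountable Y
  unbounded⇒uncountable {P = P} unb Y g g-inj j = clash (unbounded-⋃ Q unb-Q)
    where
    open Injection j using (to; injective)

    Q : ℕ → Pred Ord _
    Q n β = Σ (P β) λ q → to (g β q) ≡ n

    unb-Q : Unbounded (⋃ ℕ Q)
    unb-Q γ = let β , le , q = unb γ in β , le , to (g β q) , q , refl

    clash : ¬ (∃ λ n → Unbounded (Q n))
    clash (n , u) =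
      let β  , _   , q  , eq  = u zero
          -- `node (const β)` is the successor of `β`, which forces `β < β′`.
          β′ , le′ , q′ , eq′ = u (node (const β))
          β~β′ = g-inj q q′ (injective (trans eq (sym eq′)))
      in <-irrefl (<-≤-trans (<-≤-trans (<node 0 ≤-refl) le′) (proj₂ β~β′))

  -- Representatives and the Ulam matrix

  -- Equivalent ordinals may list their predecessors differently; passing to a chosen representative
  -- makes the `n`-th predecessor depend on the class alone.
  representatives : Σ (Func ~-setoid (setoid Ord)) λ r → ∀ α → α ~ Func.to r α
  representatives = ac _ _ _ _ ~-setoid Ord _~_
    (λ α~α′ α~β → ~-trans (~-sym α~α′) α~β) λ α → α , ~-refl

  rep : Ord → Ord
  rep = Func.to (proj₁ representatives)

  rep-cong : ∀ {α β} → α ~ β → rep α ≡ rep β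
  rep-cong = Func.cong (proj₁ representatives)

  rep-~ : ∀ {α} → α ~ rep α
  rep-~ = proj₂ representatives _

  rep-injective : ∀ {α β} → rep α ≡ rep β → α ~ β
  rep-injective {α} {β} eq = ~-trans rep-~ (subst (_~ β) (sym eq) (~-sym rep-~))

  UlamSet : ℕ → Ord → Pred Ord _
  UlamSet n α β = α < β × predecessor (rep β) n ~ α

  ulamSet-resp : ∀ {n α α′ β} → α ~ α′ → UlamSet n α β → UlamSet n α′ β
  ulamSet-resp e (p , q) = ≤-<-trans (proj₂ e) p , ~-trans q e

  ulamSet-disjoint : ∀ {n α α′ β β′} → β ~ β′ → UlamSet n α β → UlamSet n α′ β′ → α ~ α′
  ulamSet-disjoint {n} {α′ = α′} e (_ , q) (_ , q′) =
    ~-trans (~-sym q) (subst (λ γ → predecessor γ n ~ α′) (sym (rep-cong e)) q′)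

  Heavy : ℕ → Pred Ord _
  Heavy n α = Unbounded (UlamSet n α)

  heavy-resp : ∀ {n α α′} → α ~ α′ → Heavy n α → Heavy n α′
  heavy-resp e u γ = let β , le , q = u γ in β , le , ulamSet-resp e q

  ∃-heavy : ∀ α → ∃ λ n → Heavy n α
  ∃-heavy α = unbounded-⋃ (λ n → UlamSet n α) λ γ →
    -- Branch 0 puts `β` above `α`, branch 1 above `γ`.
    let β  = node λ { zero → α ; (suc _) → γ }
        lt = <node 0 ≤-refl
        n , q = predecessor-surjective (<-≤-trans lt (proj₁ (rep-~ {β})))
    in β , <⇒≤ (<node 1 ≤-refl) , n , lt , q

  ∃-unboundedlyHeavy : ∃ λ n → Unbounded (Heavy n)
  ∃-unboundedlyHeavy = unbounded-⋃ Heavy λ γ → γ , ≤-refl , ∃-heavy γ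

  -- Embedding the ordinals into an uncountable setoid

  module _ (X : Setoid a b) (X-uncountable : Uncountable X) where
    private
      module X = Setoid X
    open X using (Carrier; _≈_)

    uncountable⇒inhabited : Carrier
    uncountable⇒inhabited with decide Carrier
    ... | yes x = x
    ... | no ¬x = ⊥-elim (X-uncountable record
      { to        = ⊥-elim ∘ ¬x
      ; cong      = λ {x} _ → ⊥-elim (¬x x)
      ; injective = λ {x} _ → ⊥-elim (¬x x)
      })

    -- Choice is needed for congruence only: a witness for a single sequence
    -- comes from excluded middle.
    avoiding : Σ (Func (setoid ℕ ⇨ X) (setoid Carrier)) λ f →
               ∀ s n → ¬ Func.to f s ≈ Func.to s n
    avoiding = ac _ _ _ _ (setoid ℕ ⇨ X) Carrier (λ s x → ∀ n → ¬ x ≈ Func.to s n)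
      (λ s≈t avoids n x≈tn → avoids n (X.trans x≈tn (X.sym (s≈t n)))) avoid
      where
      avoid : ∀ s → ∃ λ x → ∀ n → ¬ x ≈ Func.to s n
      avoid s with decide (∃ λ x → ∀ n → ¬ x ≈ Func.to s n)
      ... | yes q = q
      -- If `s` hit every element, choosing an index for each would inject `X` into ℕ.
      ... | no ¬q = ⊥-elim (X-uncountable record
        { to        = Func.to index
        ; cong      = Func.cong index
        ; injective = λ {x} {y} eq → X.trans (hits x)
            (X.sym (subst (λ n → y ≈ Func.to s n) (sym eq) (hits y)))
        })
        where
        hit : ∀ x → ∃ λ n → x ≈ Func.to s n
        hit x with decide (∃ λ n → x ≈ Func.to s n)
        ... | yes h = h
        ... | no ¬h = ⊥-elim (¬q (x , λ n e → ¬h (n , e)))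

        choice : Σ (Func X (setoid ℕ)) λ f → ∀ x → x ≈ Func.to s (Func.to f x)
        choice = ac _ _ _ _ X ℕ (λ x n → x ≈ Func.to s n) (λ e h → X.trans (X.sym e) h) hit

        index = proj₁ choice
        hits  = proj₂ choice

    sequence : (ℕ → Carrier) → Func (setoid ℕ) X
    sequence s = record { to = s ; cong = λ { refl → X.refl } }

    fresh : (ℕ → Carrier) → Carrier
    fresh s = Func.to (proj₁ avoiding) (sequence s)

    fresh-cong : ∀ {s t} → (∀ n → s n ≈ t n) → fresh s ≡ fresh t
    fresh-cong = Func.cong (proj₁ avoiding)

    fresh-avoids : ∀ s n → ¬ fresh s ≈ s n
    fresh-avoids s = proj₂ avoiding (sequence s)

    mutual
      -- Transfinite recursion: each value is fresh for the values at all predecessors, read at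
      -- representatives because `embed` is.
      embedAcc : ∀ α → Acc _<_ α → Carrier
      embedAcc α (acc rs) = fresh λ n → valueAt rs n (decide (rep (predecessor α n) < α))

      valueAt : ∀ {α} → (∀ {β} → β < α → Acc _<_ β) →
                ∀ n → Dec (rep (predecessor α n) < α) → Carrier
      valueAt rs n (yes p) = embedAcc _ (rs p)
      -- A filler, reached only at `zero`; avoiding one more element is harmless.
      valueAt rs n (no _)  = uncountable⇒inhabited

    -- By induction the two avoided sequences agree pointwise, which suffices because `fresh`
    -- respects pointwise equality.
    embedAcc-irrelevant : ∀ {α} (u v : Acc _<_ α) → embedAcc α u ≡ embedAcc α v
    embedAcc-irrelevant {α} (acc rs) (acc rs′) =
      fresh-cong λ n → X.reflexive (agree n (decide (rep (predecessor α n) < α)))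
      where
      agree : ∀ n d → valueAt rs n d ≡ valueAt rs′ n d
      agree n (yes p) = embedAcc-irrelevant (rs p) (rs′ p)
      agree n (no _)  = refl

    -- `rep α` represents some listed predecessor of `rep β`, so its value is among those avoided at
    -- `rep β`.
    embedAcc-separates : ∀ {α β} → α < β → (u : Acc _<_ (rep α)) (v : Acc _<_ (rep β)) →
                         ¬ embedAcc (rep β) v ≈ embedAcc (rep α) u
    embedAcc-separates {α} {β} α<β u (acc rs) eq =
      fresh-avoids _ n (X.trans eq (X.reflexive
        (hit (rep-cong (~-trans pred~repα (~-sym rep-~))) (decide _))))
      where
      repα<repβ : rep α < rep β
      repα<repβ = ≤-<-trans (proj₂ rep-~) (<-≤-trans α<β (proj₁ rep-~))

      n = proj₁ (predecessor-surjective repα<repβ)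

      pred~repα : predecessor (rep β) n ~ rep α
      pred~repα = proj₂ (predecessor-surjective repα<repβ)

      embedAcc-cong : ∀ {γ δ} (u : Acc _<_ γ) (v : Acc _<_ δ) → γ ≡ δ →
                      embedAcc γ u ≡ embedAcc δ v
      embedAcc-cong u v refl = embedAcc-irrelevant u v

      hit : rep (predecessor (rep β) n) ≡ rep α → ∀ d → embedAcc (rep α) u ≡ valueAt rs n d
      hit e (yes p) = embedAcc-cong u (rs p) (sym e)
      hit e (no ¬p) = contradiction (subst (_< rep β) (sym e) repα<repβ) ¬p

    embed : Ord → Carrier
    embed α = embedAcc (rep α) (<-wellFounded (rep α))

    embed-injective : ∀ {α β} → embed α ≈ embed β → α ~ β
    embed-injective e = connex (λ lt → embedAcc-separates lt (<-wellFounded _) (<-wellFounded _) (X.sym e))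
                               (λ lt → embedAcc-separates lt (<-wellFounded _) (<-wellFounded _) e)

    -- Uncountably many uncountable colour classes

    fibre : {I : Set p} → Func X (setoid I) → I → Setoid _ _
    fibre κ i = On.setoid {B = ∃ λ x → Func.to κ x ≡ i} X proj₁

    uncountableColouring : ∀ p →
      ∃ λ (I : Set p) → ∃ λ (κ : Func X (setoid I)) →
      Uncountable (setoid I) × (∀ i → Uncountable (fibre κ i))
    uncountableColouring p = Index , κ , index-uncountable , fibre-uncountable
      where
      n = proj₁ ∃-unboundedlyHeavy

      heavy-unbounded : Unbounded (Heavy n)
      heavy-unbounded = proj₂ ∃-unboundedlyHeavy

      IsIndex : Ord → Set p
      IsIndex α = Lift p (rep α ≡ α × Heavy n α)

      -- The proof component is irrelevant, so indices with equal values are equal; `IsIndex` admits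
      -- only representatives, so equivalent ordinals give one index.
      Index : Set p
      Index = Refinement Ord IsIndex

      index : ∀ α → Heavy n α → Index
      index α h = rep α , [ lift (rep-cong (~-sym rep-~) , heavy-resp rep-~ h) ]

      value-injective : {i j : Index} → value i ≡ value j → i ≡ j
      value-injective refl = refl

      index-uncountable : Uncountable (setoid Index)
      index-uncountable = unbounded⇒uncountable heavy-unbounded (setoid Index) index
        λ _ _ eq → rep-injective (cong value eq)

      Coloured : Carrier → Set _
      Coloured x = ∃₂ λ α β → Heavy n α × UlamSet n α β × x ≈ embed β

      -- Elements outside the transported row join an existing class, which only enlarges it.
      default : Index
      default = let α , _ , h = heavy-unbounded zero in index α h

      colour : ∀ {x} → Dec (Coloured x) → Index
      colour (yes (α , _ , h , _)) = index α h
      colour (no _)                = default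

      colour-cong : ∀ {x y} → x ≈ y → (d : Dec (Coloured x)) (d′ : Dec (Coloured y)) →
                    colour d ≡ colour d′
      -- The witnesses may differ, but `embed-injective` gives equivalent `β` and `β′`, whose `n`-th
      -- predecessors are equivalent.
      colour-cong e (yes (α , β , _ , u , q)) (yes (α′ , β′ , _ , u′ , q′)) =
        value-injective (rep-cong (ulamSet-disjoint
          (embed-injective (X.trans (X.sym q) (X.trans e q′))) u u′))
      colour-cong e (yes (α , β , h , u , q)) (no ¬c) =
        ⊥-elim (¬c (α , β , h , u , X.trans (X.sym e) q))
      colour-cong e (no ¬c) (yes (α , β , h , u , q)) =
        ⊥-elim (¬c (α , β , h , u , X.trans e q))
      colour-cong e (no _) (no _) = refl

      κ : Func X (setoid Index)
      κ = record { to   = λ x → colour (decide (Coloured x))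
                 ; cong = λ e → colour-cong e (decide _) (decide _) }

      colour-embed : ∀ {α β} → Heavy n α → UlamSet n α β → rep α ≡ α →
                     (d : Dec (Coloured (embed β))) → value (colour d) ≡ α
      colour-embed h u eq (yes (α′ , β′ , _ , u′ , q)) =
        trans (rep-cong (ulamSet-disjoint (~-sym (embed-injective q)) u′ u)) eq
      colour-embed {α} {β} h u eq (no ¬c) = ⊥-elim (¬c (α , β , h , u , X.refl))

      fibre-uncountable : ∀ i → Uncountable (fibre κ i)
      fibre-uncountable i@(α , [ isIndex ])
        -- Decidability turns the irrelevant proof into a usable one.
        with lift (eq , h) ← recompute (decide (IsIndex α)) isIndex =
        unbounded⇒uncountable h (fibre κ i)
          (λ β u → embed β , value-injective (colour-embed h u eq (decide _)))
          λ _ _ → embed-injective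

  -- The two implications for semigroups

  module _ {c ℓ : Level} (S : Semigroup c ℓ) where
    open Semigroup S
      using (Carrier; _≈_; _∙_; ∙-congˡ)
      renaming (refl to ≈-refl; sym to ≈-sym; trans to ≈-trans)
    open Subset

    everyUncountableIsIP⇒partition :
      ((A : Subset S) → Uncountable (subsetSetoid S A) → IsIP S A) →
      (A : Subset S) → Uncountable (subsetSetoid S A) → UncountableIPPartition S A
    everyUncountableIsIP⇒partition ip A A-unc = record
      { Index       = I
      ; part        = part
      ; uncountable = I-unc
      ; disjoint    = λ i≢j ((_ , eq) , (_ , eq′)) →
          -- The two membership proofs may differ; `κ` sees only the element.
          i≢j (trans (sym eq) (trans (κ.cong ≈-refl) eq′))
      ; covers      = (λ (_ , m , _) → m) , λ m → κ.to (_ , m) , m , refl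
      ; part-IP     = λ i → ip (part i) λ j →
          let module j = Injection j in
          fibre-unc i record
            { to        = λ ((s , m) , eq) → j.to (s , m , eq)
            ; cong      = j.cong
            ; injective = j.injective
            }
      }
      where
      colouring = uncountableColouring (subsetSetoid S A) A-unc (c ⊔ ℓ)
      I         = proj₁ colouring
      module κ  = Func (proj₁ (proj₂ colouring))
      I-unc     = proj₁ (proj₂ (proj₂ colouring))
      fibre-unc = proj₂ (proj₂ (proj₂ colouring))

      part : I → Subset S
      part i = record
        { member = λ s → Σ (member A s) λ m → κ.to (s , m) ≡ i
        ; resp   = λ e (m , eq) → resp A e m , trans (κ.cong (≈-sym e)) eq
        }

    -- Off by one: `multiple s n` sums `suc n` copies of `s`, nested to the right as in `foldr₁`.
    multiple : Carrier → ℕ → Carrier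
    multiple s zero    = s
    multiple s (suc n) = s ∙ multiple s n

    FS-const : ∀ s {t} → FS S (const s) t → ∃ λ n → t ≈ multiple s n
    FS-const s ((k List⁺.∷ ks) , _ , eq) = length ks , ≈-trans eq (go k ks)
      where
      go : ∀ k ks → foldr₁ _∙_ (List⁺.map (const s) (k List⁺.∷ ks)) ≈ multiple s (length ks)
      go k []        = ≈-refl
      go k (k′ ∷ ks) = ∙-congˡ (go k′ ks)

    adjoinMultiples : Subset S → Carrier → Subset S
    adjoinMultiples A s = record
      { member = λ t → member A t ⊎ Lift (c ⊔ ℓ) (∃ λ n → t ≈ multiple s n)
      ; resp   = λ where
          e (inj₁ m)              → inj₁ (resp A e m)
          e (inj₂ (lift (n , q))) → inj₂ (lift (n , ≈-trans (≈-sym e) q))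
      }

    -- If every part met the sequence, sending a part to the position of a meeting point would be
    -- injective by disjointness, and the index set countable.
    partAvoiding : {B : Subset S} (P : UncountableIPPartition S B) (x : ℕ → Carrier) →
                   let open UncountableIPPartition P in
                   ∃ λ i → ∀ n → ¬ member (part i) (x n)
    partAvoiding P x with all⊎counterexample (λ i → ∃ λ n → member (part i) (x n))
      where open UncountableIPPartition P
    ... | inj₂ (i , ¬meets) = i , λ n m → ¬meets (n , m)
    ... | inj₁ meets        = ⊥-elim (uncountable record
      { to        = λ i → proj₁ (meets i)
      ; cong      = cong _
      ; injective = λ {i} {j} → same i j
      })
      where
      open UncountableIPPartition P

      same : ∀ i j → proj₁ (meets i) ≡ proj₁ (meets j) → i ≡ j
      same i j eq with decide (i ≡ j)
      ... | yes i≡j = i≡j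
      ... | no  i≢j = ⊥-elim (disjoint i≢j
        (subst (member (part i) ∘ x) eq (proj₂ (meets i)) , proj₂ (meets j)))

    partition⇒everyUncountableIsIP :
      ((A : Subset S) → Uncountable (subsetSetoid S A) → IsIP S A → UncountableIPPartition S A) →
      (A : Subset S) → Uncountable (subsetSetoid S A) → IsIP S A
    partition⇒everyUncountableIsIP partition A A-unc =
      let x , FSx⊆part = part-IP i in x , λ t∈FS → part⊆A (FSx⊆part t∈FS)
      where
      s = proj₁ (uncountable⇒inhabited (subsetSetoid S A) A-unc)
      B = adjoinMultiples A s

      B-unc : Uncountable (subsetSetoid S B)
      B-unc j = let module j = Injection j in A-unc record
        { to        = λ (t , m) → j.to (t , inj₁ m)
        ; cong      = j.cong
        ; injective = j.injective
        }

      -- All finite sums of the constant sequence `s` are multiples of `s`, so it witnesses that `B`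
      -- is an IP set.
      P = partition B B-unc (const s , λ t∈FS → inj₂ (lift (FS-const s t∈FS)))
      open UncountableIPPartition P

      i = proj₁ (partAvoiding P (multiple s))

      part⊆A : ∀ {t} → member (part i) t → member A t
      part⊆A m with proj₁ covers (i , m)
      ... | inj₁ q              = q
      ... | inj₂ (lift (n , e)) =
        ⊥-elim (proj₂ (partAvoiding P (multiple s)) n (resp (part i) e m))

theorem2p6 : (∀ (a : Level) → ExcludedMiddle a) →
    (∀ (a b d e : Level) → AxiomOfChoice a b d e) →
    ∀ {c ℓ : Level} (S : Semigroup c ℓ) →
    Uncountable (Semigroup.setoid S) →
    (∀ e → ¬ (_IdempotentOn_ (Semigroup._≈_ S) (Semigroup._∙_ S) e)) →
    ((A : Subset S) → Uncountable (subsetSetoid S A) → IsIP S A → UncountableIPPartition S A)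
    ⇔
    ((A : Subset S) → Uncountable (subsetSetoid S A) → IsIP S A)
theorem2p6 em ac S _ _ = mk⇔
  (partition⇒everyUncountableIsIP S)
  (λ ip A A-unc _ → everyUncountableIsIP⇒partition S ip A A-unc)
  where open Classical em ac
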